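{- There exists a set $C$ of $333$ three-dimensional subspaces of $\mathbb{F}_2^7$ such that any two distinct members of $C$ intersect in a subspace of dimension at most $1$ (equivalently, a set of $333$ planes of $\operatorname{PG}(6,2)$ mutually intersecting in at most a point). Consequently $A_2(7,4;3)\ge 333$. Moreover, such a $C$ can be chosen so that its automorphism group $\operatorname{Aut}(C)$ is isomorphic to the Klein four-group $Z_2\times Z_2$; specifically, $\operatorname{Aut}(C)$ is the group generated by the two matrices \[ M_1=\begin{pmatrix} 0&0&1&0&0&0&0\\ 0&0&0&0&1&0&0\\ 1&0&0&0&0&0&0\\ 0&1&0&1&1&0&0\\ 0&1&0&0&0&0&0\\ 0&1&0&0&1&1&0\\ 1&0&1&1&1&0&1 \end{pmatrix},\qquad M_2=\begin{pmatrix} 1&1&0&0&0&1&0\\ 1&1&0&1&1&0&1\\ 0&1&1&0&0&1&0\\ 1&0&0&1&0&0&1\\ 1&0&0&0&1&0&1\\ 1&0&0&1&1&1&1\\ 0&1&0&0&0&1&1 \end{pmatrix} \] in $\operatorname{GL}(7,2)$.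
   Context: For subspaces $U,W$ of $\mathbb{F}_q^n$ the subspace distance is $d_S(U,W)=\dim(U+W)-\dim(U\cap W)$. $A_q(n,d;k)$ denotes the maximum cardinality of a set of $k$-dimensional subspaces of $\mathbb{F}_q^n$ with pairwise subspace distance at least $d$; for $k=3$, $d=4$ this means any two distinct members intersect in dimension at most $1$. Elements of $\mathbb{F}_2^7$ are row vectors; a matrix $M\in\operatorname{GL}(7,2)$ acts on a subspace $K$ by $K\cdot M=\{vM : v\in K\}$ (i.e. the row space of $AM$ where $A$ is a matrix whose rows span $K$). For a set $C$ of subspaces, $M$ is an automorphism of $C$ if $\{K\cdot M: K\in C\}=C$, and $\operatorname{Aut}(C)$ is the group of all automorphisms of $C$ in $\operatorname{GL}(7,2)$. -}

module Defs where

open import Data.Bool using (Bool; true; false; _xor_; _∧_)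
open import Data.Nat using (ℕ)
open import Data.Fin using (Fin)
open import Data.Fin.Properties using (_≟_)
open import Data.Vec using (Vec; []; _∷_; replicate; zipWith; foldr; map; tabulate)
open import Data.Product using (Σ; ∃; _×_; _,_)
open import Data.List using (List; length)
open import Data.List.Membership.Propositional using (_∈_)
open import Data.List.Relation.Unary.All using (All)
open import Data.List.Relation.Unary.AllPairs using (AllPairs)
open import Relation.Binary.PropositionalEquality using (_≡_)
open import Relation.Nullary using (¬_)
open import Relation.Nullary.Decidable using (⌊_⌋)

-- F_2 is Bool with addition = xor and multiplication = ∧.
-- Vectors of F_2^n are row vectors  Vec Bool n.
Vect : ℕ → Set
Vect n = Vec Bool n

zeroV : (n : ℕ) → Vect n
zeroV n = replicate n false

infixl 6 _+v_
_+v_ : {n : ℕ} → Vect n → Vect n → Vect n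
_+v_ = zipWith _xor_

infixl 7 _·v_
_·v_ : {n : ℕ} → Bool → Vect n → Vect n
b ·v v = map (b ∧_) v

-- square n×n matrices over F_2, given as a vector of rows
Mat : ℕ → Set
Mat n = Vec (Vect n) n

vecMul : {n : ℕ} → Vect n → Mat n → Vect n
vecMul {n} v M = foldr (λ _ → Vect n) _+v_ (zeroV n) (zipWith _·v_ v M)

matMul : {n : ℕ} → Mat n → Mat n → Mat n
matMul A B = map (λ r → vecMul r B) A

identity : (n : ℕ) → Mat n
identity n = tabulate (λ i → tabulate (λ j → ⌊ i ≟ j ⌋))

Invertible : {n : ℕ} → Mat n → Set
Invertible {n} M = ∃ λ N → (matMul M N ≡ identity n) × (matMul N M ≡ identity n)

-- Three-dimensional subspaces of F_2^7, given by a basis (a, b, c).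

V7 : Set
V7 = Vect 7

Triple : Set
Triple = V7 × V7 × V7

_∈S_ : V7 → Triple → Set
x ∈S (a , b , c) = ∃ λ (s : Bool) → ∃ λ (t : Bool) → ∃ λ (u : Bool) →
  x ≡ s ·v a +v t ·v b +v u ·v c

IsPlane : Triple → Set
IsPlane (a , b , c) = ∀ (s t u : Bool) → s ·v a +v t ·v b +v u ·v c ≡ zeroV 7 →
  (s ≡ false) × (t ≡ false) × (u ≡ false)

SameSpace : Triple → Triple → Set
SameSpace U W = ∀ x → ((x ∈S U → x ∈S W) × (x ∈S W → x ∈S U))

LinIndep2 : V7 → V7 → Set
LinIndep2 x y = ∀ (s t : Bool) → s ·v x +v t ·v y ≡ zeroV 7 → (s ≡ false) × (t ≡ false)

IntersectDimLe1 : Triple → Triple → Set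
IntersectDimLe1 U W = ¬ (∃ λ x → ∃ λ y →
  (x ∈S U) × (x ∈S W) × (y ∈S U) × (y ∈S W) × LinIndep2 x y)

IsCode : List Triple → Set
IsCode C = All IsPlane C
         × AllPairs (λ U W → ¬ SameSpace U W) C
         × AllPairs IntersectDimLe1 C

imageT : Triple → Mat 7 → Triple
imageT (a , b , c) M = vecMul a M , vecMul b M , vecMul c M

IsAut : List Triple → Mat 7 → Set
IsAut C M = (∀ K → K ∈ C → ∃ λ K' → (K' ∈ C) × SameSpace (imageT K M) K')
          × (∀ K' → K' ∈ C → ∃ λ K → (K ∈ C) × SameSpace (imageT K M) K')

-- The subgroup of GL(7,2) generated by two matrices (a finite group, so
-- the generated submonoid equals the generated subgroup).

data Generated (A B : Mat 7) : Mat 7 → Set where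
  gen-id : Generated A B (identity 7)
  gen-A  : ∀ {X} → Generated A B X → Generated A B (matMul X A)
  gen-B  : ∀ {X} → Generated A B X → Generated A B (matMul X B)

kleinOp : Bool × Bool → Bool × Bool → Bool × Bool
kleinOp (a , b) (c , d) = (a xor c , b xor d)

IsoToKlein : (Mat 7 → Set) → Set
IsoToKlein P = ∃ λ (φ : Bool × Bool → Mat 7) →
    (∀ g h → φ (kleinOp g h) ≡ matMul (φ g) (φ h))
  × (∀ g h → φ g ≡ φ h → g ≡ h)
  × (∀ M → (P M → ∃ λ g → φ g ≡ M) × ((∃ λ g → φ g ≡ M) → P M))

M1 : Mat 7
M1 = (false ∷ false ∷ true  ∷ false ∷ false ∷ false ∷ false ∷ [])
   ∷ (false ∷ false ∷ false ∷ false ∷ true  ∷ false ∷ false ∷ [])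
   ∷ (true  ∷ false ∷ false ∷ false ∷ false ∷ false ∷ false ∷ [])
   ∷ (false ∷ true  ∷ false ∷ true  ∷ true  ∷ false ∷ false ∷ [])
   ∷ (false ∷ true  ∷ false ∷ false ∷ false ∷ false ∷ false ∷ [])
   ∷ (false ∷ true  ∷ false ∷ false ∷ true  ∷ true  ∷ false ∷ [])
   ∷ (true  ∷ false ∷ true  ∷ true  ∷ true  ∷ false ∷ true  ∷ [])
   ∷ []

M2 : Mat 7
M2 = (true  ∷ true  ∷ false ∷ false ∷ false ∷ true  ∷ false ∷ [])
   ∷ (true  ∷ true  ∷ false ∷ true  ∷ true  ∷ false ∷ true  ∷ [])
   ∷ (false ∷ true  ∷ true  ∷ false ∷ false ∷ true  ∷ false ∷ [])
   ∷ (true  ∷ false ∷ false ∷ true  ∷ false ∷ false ∷ true  ∷ [])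
   ∷ (true  ∷ false ∷ false ∷ false ∷ true  ∷ false ∷ true  ∷ [])
   ∷ (true  ∷ false ∷ false ∷ true  ∷ true  ∷ true  ∷ true  ∷ [])
   ∷ (false ∷ true  ∷ false ∷ false ∷ false ∷ true  ∷ true  ∷ [])
   ∷ []

-- The code is a union of orbits of the Klein four-group on planes. That two planes never share a
-- line is read off a table which assigns to two points the plane through them. For the
-- automorphism group, colour every point by iterated refinement along the lines that lie in no
-- plane of the code. Automorphisms preserve the colours, and matching the colours of all linear
-- combinations while choosing the images of the standard basis leaves only eight matrices; the
-- four outside the Klein four-group do not preserve the code.

module Submission where

open import Defs
open import Algebra.Bundles using (CommutativeRing)
import Algebra.Properties.CommutativeSemigroup as CommutativeSemigroup
open import Data.Bool as Bool using (Bool; true; false; _xor_; if_then_else_; T)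
open import Data.Bool.ListAction using (all)
open import Data.Bool.Properties
  using (xor-identityˡ; xor-identityʳ; xor-same; xor-∧-commutativeRing; ⇔→≡)
open import Data.Empty using (⊥)
open import Data.List as List using (List; []; _∷_; _++_; length; concatMap; cartesianProduct)
import Data.List.Membership.DecPropositional as DecMembership
open import Data.List.Membership.Propositional using (_∈_; find; lose)
open import Data.List.Membership.Propositional.Properties
  using (∈-map⁺; ∈-map⁻; ∈-++⁺ˡ; ∈-++⁺ʳ; ∈-cartesianProduct⁺; ∈-cartesianProduct⁻;
         ∈-concatMap⁺; ∈-concatMap⁻)
open import Data.List.Membership.Propositional.Properties.WithK using (unique∧set⇒bag)
import Data.List.Properties as List
open import Data.List.Relation.Binary.BagAndSetEquality using (∼bag⇒↭)
open import Data.List.Relation.Binary.Permutation.Propositional using (_↭_)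
import Data.List.Relation.Binary.Permutation.Propositional.Properties as ↭
open import Data.List.Relation.Unary.All as All using (All; []; _∷_)
import Data.List.Relation.Unary.All.Properties as All
open import Data.List.Relation.Unary.AllPairs using (AllPairs; []; _∷_)
open import Data.List.Relation.Unary.Any using (here; there)
open import Data.List.Relation.Unary.Unique.Propositional using (Unique)
import Data.List.Relation.Unary.Unique.DecPropositional as DecUnique
import Data.List.Relation.Unary.Unique.Propositional.Properties as Unique
open import Data.Maybe as Maybe using (Maybe; just; nothing; is-just)
import Data.Maybe.Properties as Maybe
import Data.Maybe.Relation.Unary.Any as Maybe
open import Data.Nat using (ℕ; zero; suc; _*_; _≡ᵇ_)
open import Data.Nat.DivMod using (_/_; _%_)
open import Data.Nat.ListAction using (sum)
open import Data.Nat.ListAction.Properties using (sum-↭)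
open import Data.Nat.Properties using (≡⇒≡ᵇ)
open import Data.Product using (∃; _×_; _,_; proj₁; proj₂; map₂)
import Data.Product.Properties as Product
open import Data.Sum using (_⊎_; inj₁; inj₂; [_,_]′)
open import Data.Unit using (tt)
open import Data.Vec as Vec using (Vec; []; _∷_)
import Data.Vec.Properties as Vec
open import Function using (_∘_; mk⇔)
open import Relation.Binary.Definitions using (DecidableEquality)
open import Relation.Binary.PropositionalEquality
open import Relation.Nullary using (Dec; ¬_; ¬?; _⊎-dec_; _×-dec_; _→-dec_; contradiction)
open import Relation.Nullary.Decidable using (⌊_⌋; toWitness)

private
  variable
    A   : Set
    m n : ℕ

_≟V_ : DecidableEquality (Vect n)
_≟V_ = Vec.≡-dec Bool._≟_

_≟T_ : DecidableEquality Triple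
_≟T_ = Product.≡-dec _≟V_ (Product.≡-dec _≟V_ _≟V_)

_≟M_ : DecidableEquality (Mat n)
_≟M_ = Vec.≡-dec _≟V_

open DecMembership (_≟V_ {7}) using (_∈?_)
open DecMembership (_≟M_ {7}) using () renaming (_∈?_ to _∈M?_)
open DecUnique _≟T_ using (unique?)

-- Linear algebra over F_2

+v-identityˡ : (x : Vect n) → zeroV n +v x ≡ x
+v-identityˡ = Vec.zipWith-identityˡ xor-identityˡ

+v-identityʳ : (x : Vect n) → x +v zeroV n ≡ x
+v-identityʳ = Vec.zipWith-identityʳ xor-identityʳ

+v-self : (x : Vect n) → x +v x ≡ zeroV n
+v-self []      = refl
+v-self (a ∷ x) = cong₂ _∷_ (xor-same a) (+v-self x)

+v-interchange : (w x y z : Vect n) → (w +v x) +v (y +v z) ≡ (w +v y) +v (x +v z)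
+v-interchange []      []      []      []      = refl
+v-interchange (a ∷ w) (b ∷ x) (c ∷ y) (d ∷ z) =
  cong₂ _∷_ (interchange a b c d) (+v-interchange w x y z)
  where
  open CommutativeSemigroup
    (CommutativeRing.+-commutativeSemigroup xor-∧-commutativeRing)
    using (interchange)

true·v : (x : Vect n) → true ·v x ≡ x
true·v = Vec.map-id

false·v : (x : Vect n) → false ·v x ≡ zeroV n
false·v x = Vec.map-const x false

·v-zeroV : ∀ s → s ·v zeroV n ≡ zeroV n
·v-zeroV true  = true·v _
·v-zeroV false = false·v _

·v-distribˡ : ∀ s (x y : Vect n) → s ·v (x +v y) ≡ s ·v x +v s ·v y
·v-distribˡ true  x y = trans (true·v _) (sym (cong₂ _+v_ (true·v x) (true·v y)))
·v-distribˡ false x y = trans (false·v _)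
  (sym (trans (cong₂ _+v_ (false·v x) (false·v y)) (+v-identityˡ _)))

·v-distribʳ : ∀ s t (x : Vect n) → (s xor t) ·v x ≡ s ·v x +v t ·v x
·v-distribʳ false t     x = sym (trans (cong (_+v t ·v x) (false·v x)) (+v-identityˡ _))
·v-distribʳ true  false x = sym (trans (cong (true ·v x +v_) (false·v x)) (+v-identityʳ _))
·v-distribʳ true  true  x = trans (false·v x) (sym (+v-self _))

-- The fold inside `vecMul`, for any number of rows. Induction removes one row but keeps the row
-- length, so the two sizes must be independent.
linearCombination : Vec Bool m → Vec (Vect n) m → Vect n
linearCombination x rows = Vec.foldr (λ _ → Vect _) _+v_ (zeroV _) (Vec.zipWith _·v_ x rows)

linearCombination-zeroV : (rows : Vec (Vect n) m) →
  linearCombination (zeroV m) rows ≡ zeroV n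
linearCombination-zeroV []         = refl
linearCombination-zeroV (r ∷ rows) =
  trans (cong₂ _+v_ (false·v r) (linearCombination-zeroV rows)) (+v-identityˡ _)

linearCombination-+v : (x y : Vec Bool m) (rows : Vec (Vect n) m) →
  linearCombination (x +v y) rows ≡ linearCombination x rows +v linearCombination y rows
linearCombination-+v []      []      []         = sym (+v-identityˡ _)
linearCombination-+v (s ∷ x) (t ∷ y) (r ∷ rows) =
  trans (cong₂ _+v_ (·v-distribʳ s t r) (linearCombination-+v x y rows))
        (+v-interchange (s ·v r) (t ·v r) _ _)

vecMul-zeroV : (M : Mat n) → vecMul (zeroV n) M ≡ zeroV n
vecMul-zeroV = linearCombination-zeroV

vecMul-+v : (x y : Vect n) (M : Mat n) → vecMul (x +v y) M ≡ vecMul x M +v vecMul y M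
vecMul-+v = linearCombination-+v

vecMul-·v : ∀ s (x : Vect n) (M : Mat n) → vecMul (s ·v x) M ≡ s ·v vecMul x M
vecMul-·v true  x M = trans (cong (λ y → vecMul y M) (true·v x)) (sym (true·v _))
vecMul-·v false x M =
  trans (cong (λ y → vecMul y M) (false·v x)) (trans (vecMul-zeroV M) (sym (false·v _)))

vecMul-linearCombination : (x : Vec Bool m) (rows : Vec (Vect n) m) (M : Mat n) →
  vecMul (linearCombination x rows) M ≡ linearCombination x (Vec.map (λ r → vecMul r M) rows)
vecMul-linearCombination []      []         M = vecMul-zeroV M
vecMul-linearCombination (s ∷ x) (r ∷ rows) M =
  trans (vecMul-+v (s ·v r) _ M)
        (cong₂ _+v_ (vecMul-·v s r M) (vecMul-linearCombination x rows M))

vecMul-matMul : (x : Vect n) (M N : Mat n) → vecMul (vecMul x M) N ≡ vecMul x (matMul M N)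
vecMul-matMul = vecMul-linearCombination

matMul-assoc : (L M N : Mat n) → matMul (matMul L M) N ≡ matMul L (matMul M N)
matMul-assoc L M N =
  trans (sym (Vec.map-∘ _ _ L)) (Vec.map-cong (λ r → vecMul-matMul r M N) L)

-- Enumeration of the vectors

vectors : ∀ n → List (Vect n)
vectors zero    = [] ∷ []
vectors (suc n) = List.map (false ∷_) (vectors n) ++ List.map (true ∷_) (vectors n)

∈-vectors : (x : Vect n) → x ∈ vectors n
∈-vectors []          = here refl
∈-vectors (false ∷ x) = ∈-++⁺ˡ (∈-map⁺ (false ∷_) (∈-vectors x))
∈-vectors (true  ∷ x) = ∈-++⁺ʳ _ (∈-map⁺ (true ∷_) (∈-vectors x))

vectors-unique : ∀ n → Unique (vectors n)
vectors-unique zero    = [] ∷ []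
vectors-unique (suc n) = Unique.++⁺
  (Unique.map⁺ Vec.∷-injectiveʳ (vectors-unique n))
  (Unique.map⁺ Vec.∷-injectiveʳ (vectors-unique n))
  (λ (p , q) → disjoint (∈-map⁻ _ p) (∈-map⁻ _ q))
  where
  disjoint : {x : Vect (suc n)} →
    (∃ λ y → y ∈ vectors n × x ≡ false ∷ y) → (∃ λ y → y ∈ vectors n × x ≡ true ∷ y) → ⊥
  disjoint (_ , _ , refl) (_ , _ , ())

-- Decided by evaluating all 128 vectors, which avoids reasoning about the tabulated identity
-- matrix.
vecMul-identity : (x : V7) → vecMul x (identity 7) ≡ x
vecMul-identity x =
  All.lookup (toWitness {a? = All.all? (λ x → vecMul x (identity 7) ≟V x) (vectors 7)} _)
             (∈-vectors x)

matMul-identityʳ : (M : Mat 7) → matMul M (identity 7) ≡ M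
matMul-identityʳ M = trans (Vec.map-cong vecMul-identity M) (Vec.map-id M)

-- Writing the identity as `M` times its inverse reduces the claim to the right identity law by
-- associativity.
matMul-identityˡ : (M : Mat 7) → Invertible M → matMul (identity 7) M ≡ M
matMul-identityˡ M (N , MN , NM) =
  trans (cong (λ X → matMul X M) (sym MN))
        (trans (matMul-assoc M N M) (trans (cong (matMul M) NM) (matMul-identityʳ M)))

vecMul-inverse : {M N : Mat 7} → matMul M N ≡ identity 7 →
  ∀ x → vecMul (vecMul x M) N ≡ x
vecMul-inverse MN x =
  trans (vecMul-matMul x _ _) (trans (cong (vecMul x) MN) (vecMul-identity x))

-- A bijection sends the duplicate-free list of all vectors to another one with the same members.
-- The two lists are therefore permutations of each other and give equal sums.
sum-reindex : (f f⁻¹ : Vect n → Vect n) → (∀ x → f⁻¹ (f x) ≡ x) → (∀ x → f (f⁻¹ x) ≡ x) →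
  (w : Vect n → ℕ) → sum (List.map w (vectors n)) ≡ sum (List.map (w ∘ f) (vectors n))
sum-reindex {n} f f⁻¹ f⁻¹∘f f∘f⁻¹ w =
  trans (sum-↭ (↭.map⁺ w permuted)) (cong sum (sym (List.map-∘ (vectors n))))
  where
  permuted : vectors n ↭ List.map f (vectors n)
  permuted = ∼bag⇒↭ (unique∧set⇒bag (vectors-unique n)
    (Unique.map⁺ (λ {x} {y} eq → trans (sym (f⁻¹∘f x)) (trans (cong f⁻¹ eq) (f⁻¹∘f y)))
                 (vectors-unique n))
    (λ {x} → mk⇔
      (λ _ → subst (_∈ List.map f (vectors n)) (f∘f⁻¹ x) (∈-map⁺ f (∈-vectors (f⁻¹ x))))
      (λ _ → ∈-vectors x)))

-- Planes

bools : List Bool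
bools = false ∷ true ∷ []

∈-bools : ∀ b → b ∈ bools
∈-bools false = here refl
∈-bools true  = there (here refl)

-- Opaque, so that the type checker does not expand points K and pairs K symbolically.
opaque
  coefficients : List (Bool × Bool × Bool)
  coefficients = cartesianProduct bools (cartesianProduct bools bools)

  ∈-coefficients : ∀ s t u → (s , t , u) ∈ coefficients
  ∈-coefficients s t u =
    ∈-cartesianProduct⁺ (∈-bools s) (∈-cartesianProduct⁺ (∈-bools t) (∈-bools u))

combine : Triple → Bool × Bool × Bool → V7
combine (a , b , c) (s , t , u) = s ·v a +v t ·v b +v u ·v c

points : Triple → List V7
points K = List.map (combine K) coefficients

∈-points⁺ : ∀ {x} K → x ∈S K → x ∈ points K
∈-points⁺ K@(_ , _ , _) (s , t , u , refl) = ∈-map⁺ (combine K) (∈-coefficients s t u)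

∈-points⁻ : ∀ x K → x ∈ points K → x ∈S K
∈-points⁻ x K@(_ , _ , _) x∈K with (s , t , u) , _ , eq ← ∈-map⁻ (combine K) x∈K = s , t , u , eq

a∈S : ∀ a b c → a ∈S (a , b , c)
a∈S a b c = true , false , false , sym
  (trans (cong₂ _+v_ (trans (cong₂ _+v_ (true·v a) (false·v b)) (+v-identityʳ a)) (false·v c))
         (+v-identityʳ a))

b∈S : ∀ a b c → b ∈S (a , b , c)
b∈S a b c = false , true , false , sym
  (trans (cong₂ _+v_ (trans (cong₂ _+v_ (false·v a) (true·v b)) (+v-identityˡ b)) (false·v c))
         (+v-identityʳ b))

c∈S : ∀ a b c → c ∈S (a , b , c)
c∈S a b c = false , false , true , sym
  (trans (cong₂ _+v_ (trans (cong₂ _+v_ (false·v a) (false·v b)) (+v-identityˡ _)) (true·v c))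
         (+v-identityˡ c))

∈S-+v : ∀ {x y} W → x ∈S W → y ∈S W → (x +v y) ∈S W
∈S-+v (a , b , c) (s , t , u , refl) (s′ , t′ , u′ , refl) =
  s xor s′ , t xor t′ , u xor u′ ,
  trans (+v-interchange (s ·v a +v t ·v b) _ _ _)
    (sym (cong₂ _+v_
      (trans (cong₂ _+v_ (·v-distribʳ s s′ a) (·v-distribʳ t t′ b))
             (+v-interchange (s ·v a) _ _ _))
      (·v-distribʳ u u′ c)))

∈S-·v : ∀ {x} W s → x ∈S W → (s ·v x) ∈S W
∈S-·v {x} W             true  x∈W = subst (_∈S W) (sym (true·v x)) x∈W
∈S-·v {x} (a , b , c)   false x∈W =
  false , false , false ,
  trans (false·v x) (sym (trans
    (cong₂ _+v_ (trans (cong₂ _+v_ (false·v a) (false·v b)) (+v-identityˡ _)) (false·v c))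
    (+v-identityˡ _)))

-- Inclusion of subspaces in decidable form: it is enough to look for the three basis vectors among
-- the eight combinations.
SpannedIn : Triple → Triple → Set
SpannedIn (a , b , c) W = a ∈ points W × b ∈ points W × c ∈ points W

spannedIn? : ∀ U W → Dec (SpannedIn U W)
spannedIn? (a , b , c) W = a ∈? points W ×-dec b ∈? points W ×-dec c ∈? points W

spannedIn⁺ : ∀ U W → (∀ x → x ∈S U → x ∈S W) → SpannedIn U W
spannedIn⁺ (a , b , c) W U⊆W =
  ∈-points⁺ W (U⊆W a (a∈S a b c)) ,
  ∈-points⁺ W (U⊆W b (b∈S a b c)) ,
  ∈-points⁺ W (U⊆W c (c∈S a b c))

spannedIn⁻ : ∀ U W → SpannedIn U W → ∀ x → x ∈S U → x ∈S W
spannedIn⁻ (a , b , c) W (a∈W , b∈W , c∈W) _ (s , t , u , refl) =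
  ∈S-+v W (∈S-+v W (∈S-·v W s (∈-points⁻ a W a∈W)) (∈S-·v W t (∈-points⁻ b W b∈W)))
          (∈S-·v W u (∈-points⁻ c W c∈W))

SameSpace-sym : ∀ U W → SameSpace U W → SameSpace W U
SameSpace-sym _ _ U≈W x = proj₂ (U≈W x) , proj₁ (U≈W x)

SameSpace-trans : ∀ U V W → SameSpace U V → SameSpace V W → SameSpace U W
SameSpace-trans _ _ _ U≈V V≈W x =
  (λ p → proj₁ (V≈W x) (proj₁ (U≈V x) p)) , (λ p → proj₂ (U≈V x) (proj₂ (V≈W x) p))

vecMul-combine : ∀ K k (M : Mat 7) → vecMul (combine K k) M ≡ combine (imageT K M) k
vecMul-combine (a , b , c) (s , t , u) M =
  trans (vecMul-+v (s ·v a +v t ·v b) (u ·v c) M)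
    (cong₂ _+v_ (trans (vecMul-+v (s ·v a) (t ·v b) M)
                       (cong₂ _+v_ (vecMul-·v s a M) (vecMul-·v t b M)))
                (vecMul-·v u c M))

∈S-image⁺ : ∀ {x} K M → x ∈S K → vecMul x M ∈S imageT K M
∈S-image⁺ K@(_ , _ , _) M (s , t , u , refl) = s , t , u , vecMul-combine K (s , t , u) M

∈S-image⁻ : ∀ {y} K M → y ∈S imageT K M → ∃ λ x → x ∈S K × y ≡ vecMul x M
∈S-image⁻ K@(_ , _ , _) M (s , t , u , refl) =
  combine K (s , t , u) , (s , t , u , refl) , sym (vecMul-combine K (s , t , u) M)

image-cong : ∀ U W M → SameSpace U W → SameSpace (imageT U M) (imageT W M)
image-cong U W M U≈W y = half U W (λ x → proj₁ (U≈W x)) , half W U (λ x → proj₂ (U≈W x))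
  where
  half : ∀ U W → (∀ x → x ∈S U → x ∈S W) → y ∈S imageT U M → y ∈S imageT W M
  half U W U⊆W y∈U with x , x∈U , refl ← ∈S-image⁻ U M y∈U = ∈S-image⁺ W M (U⊆W x x∈U)

image-identity : ∀ K → imageT K (identity 7) ≡ K
image-identity (a , b , c) =
  cong₂ _,_ (vecMul-identity a) (cong₂ _,_ (vecMul-identity b) (vecMul-identity c))

image-matMul : ∀ K M N → imageT (imageT K M) N ≡ imageT K (matMul M N)
image-matMul (a , b , c) M N =
  cong₂ _,_ (vecMul-matMul a M N) (cong₂ _,_ (vecMul-matMul b M N) (vecMul-matMul c M N))

-- Over F_2 the nontrivial relations between two vectors are x = 0, y = 0 and x + y = 0, so this is
-- linear dependence in decidable form.
Degenerate : V7 → V7 → Set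
Degenerate x y = x ≡ zeroV 7 ⊎ y ≡ zeroV 7 ⊎ x ≡ y

independent⇒¬degenerate : ∀ {x y} → LinIndep2 x y → ¬ Degenerate x y
independent⇒¬degenerate {x} {y} ind (inj₁ refl) with
  () ← proj₁ (ind true false (trans (cong₂ _+v_ (true·v x) (false·v y)) (+v-identityʳ x)))
independent⇒¬degenerate {x} {y} ind (inj₂ (inj₁ refl)) with
  () ← proj₂ (ind false true (trans (cong₂ _+v_ (false·v x) (true·v y)) (+v-identityˡ y)))
independent⇒¬degenerate {x} {y} ind (inj₂ (inj₂ refl)) with
  () ← proj₁ (ind true true (trans (cong₂ _+v_ (true·v x) (true·v x)) (+v-self x)))

plane-independent : ∀ a b c → IsPlane (a , b , c) → LinIndep2 a b
plane-independent a b c plane s t eq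
  with s≡ , t≡ , _ ← plane s t false
    (trans (cong₂ _+v_ eq (false·v c)) (+v-identityʳ _)) = s≡ , t≡

isPlane? : ∀ K → Dec (All (λ k → combine K k ≡ zeroV 7 → k ≡ (false , false , false)) coefficients)
isPlane? K = All.all? (λ k → combine K k ≟V zeroV 7 →-dec
  Product.≡-dec Bool._≟_ (Product.≡-dec Bool._≟_ Bool._≟_) k _) coefficients

isPlane : ∀ {K} → All (λ k → combine K k ≡ zeroV 7 → k ≡ (false , false , false)) coefficients →
  IsPlane K
isPlane {_ , _ , _} all-k s t u eq with refl ← All.lookup all-k (∈-coefficients s t u) eq =
  refl , refl , refl

-- Tries indexed by vectors

-- A lookup follows one branch per bit, so tables keyed by 7 or 14 bits stay cheap enough to
-- evaluate during type checking.
data Trie (A : Set) : ℕ → Set where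
  leaf : A → Trie A zero
  node : Trie A n → Trie A n → Trie A (suc n)

lookup : Trie A n → Vect n → A
lookup (leaf a)   []          = a
lookup (node l r) (false ∷ x) = lookup l x
lookup (node l r) (true  ∷ x) = lookup r x

tabulate : (Vect n → A) → Trie A n
tabulate {zero}  f = leaf (f [])
tabulate {suc n} f = node (tabulate (f ∘ (false ∷_))) (tabulate (f ∘ (true ∷_)))

lookup-tabulate : (f : Vect n → A) → ∀ x → lookup (tabulate f) x ≡ f x
lookup-tabulate f []          = refl
lookup-tabulate f (false ∷ x) = lookup-tabulate (f ∘ (false ∷_)) x
lookup-tabulate f (true  ∷ x) = lookup-tabulate (f ∘ (true ∷_)) x

insert : Vect n → A → Trie A n → Trie A n
insert []          v (leaf a)   = leaf v
insert (false ∷ k) v (node l r) = node (insert k v l) r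
insert (true  ∷ k) v (node l r) = node l (insert k v r)

lookup-insert-same : ∀ k (v : A) (τ : Trie A n) → lookup (insert k v τ) k ≡ v
lookup-insert-same []          v (leaf a)   = refl
lookup-insert-same (false ∷ k) v (node l r) = lookup-insert-same k v l
lookup-insert-same (true  ∷ k) v (node l r) = lookup-insert-same k v r

lookup-insert : ∀ k (v : A) (τ : Trie A n) x →
  (x ≡ k × lookup (insert k v τ) x ≡ v) ⊎ lookup (insert k v τ) x ≡ lookup τ x
lookup-insert []          v (leaf a)   []          = inj₁ (refl , refl)
lookup-insert (false ∷ k) v (node l r) (true  ∷ x) = inj₂ refl
lookup-insert (true  ∷ k) v (node l r) (false ∷ x) = inj₂ refl
lookup-insert (false ∷ k) v (node l r) (false ∷ x) with lookup-insert k v l x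
... | inj₁ (refl , eq) = inj₁ (refl , eq)
... | inj₂ eq          = inj₂ eq
lookup-insert (true ∷ k) v (node l r) (true ∷ x) with lookup-insert k v r x
... | inj₁ (refl , eq) = inj₁ (refl , eq)
... | inj₂ eq          = inj₂ eq

-- Of several pairs with the same key, the first in the list is inserted last and prevails.
fromList : List (Vect n × A) → Trie (Maybe A) n
fromList []              = tabulate (λ _ → nothing)
fromList ((k , v) ∷ kvs) = insert k (just v) (fromList kvs)

fromList-sound : ∀ (kvs : List (Vect n × A)) {k v} →
  lookup (fromList kvs) k ≡ just v → (k , v) ∈ kvs
fromList-sound [] {k} eq with () ← trans (sym (lookup-tabulate (λ _ → nothing) k)) eq
fromList-sound ((k′ , v′) ∷ kvs) {k} eq with lookup-insert k′ (just v′) (fromList kvs) k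
... | inj₁ (refl , eq′) with refl ← trans (sym eq′) eq = here refl
... | inj₂ eq′ = there (fromList-sound kvs (trans (sym eq′) eq))

-- Only some value is promised, since an earlier pair with the same key may have replaced `v`.
fromList-complete : ∀ (kvs : List (Vect n × A)) {k v} →
  (k , v) ∈ kvs → ∃ λ v′ → lookup (fromList kvs) k ≡ just v′
fromList-complete ((k , v) ∷ kvs) (here refl) = v , lookup-insert-same k (just v) (fromList kvs)
fromList-complete ((k′ , v′) ∷ kvs) {k} (there k∈) with lookup-insert k′ (just v′) (fromList kvs) k
... | inj₁ (_ , eq) = v′ , eq
... | inj₂ eq       = map₂ (trans eq) (fromList-complete kvs k∈)

-- Planes through two given points

pairs : Triple → List (V7 × V7)
pairs K = cartesianProduct (points K) (points K)

-- The key joins two points into 14 bits. Degenerate pairs are stored too, and for them several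
-- planes may compete for one key.
entry : Triple → V7 × V7 → Vect 14 × Triple
entry K (x , y) = x Vec.++ y , K

entries : Triple → List (Vect 14 × Triple)
entries K = List.map (entry K) (pairs K)

PlaneTable : Set
PlaneTable = Trie (Maybe Triple) 14

∈-pairs⁺ : ∀ {x y} K → x ∈S K → y ∈S K → (x , y) ∈ pairs K
∈-pairs⁺ K x∈K y∈K = ∈-cartesianProduct⁺ (∈-points⁺ K x∈K) (∈-points⁺ K y∈K)

∈-pairs⁻ : ∀ x y K → (x , y) ∈ pairs K → x ∈S K × y ∈S K
∈-pairs⁻ x y K p with x∈ , y∈ ← ∈-cartesianProduct⁻ (points K) (points K) {x , y} p =
  ∈-points⁻ x K x∈ , ∈-points⁻ y K y∈

planeTable : List Triple → PlaneTable
planeTable C = fromList (concatMap entries C)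

through : PlaneTable → V7 → V7 → Maybe Triple
through τ x y = lookup τ (x Vec.++ y)

through-sound : ∀ C x y {K} → through (planeTable C) x y ≡ just K → K ∈ C × x ∈S K × y ∈S K
through-sound C x y eq
  with K , K∈C , e∈ ← find (∈-concatMap⁻ entries (fromList-sound (concatMap entries C) eq))
  with (x′ , y′) , p∈ , eq′ ← ∈-map⁻ (entry K) e∈
  with refl ← Product.,-injectiveʳ eq′
  with refl , refl ← Vec.++-injective x x′ (Product.,-injectiveˡ eq′)
  = K∈C , ∈-pairs⁻ x y K p∈

through-complete : ∀ C {x y K} → K ∈ C → x ∈S K → y ∈S K →
  ∃ λ K′ → through (planeTable C) x y ≡ just K′
through-complete C {x} {y} {K} K∈C x∈K y∈K =
  fromList-complete (concatMap entries C)
    (∈-concatMap⁺ entries (lose K∈C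
      (∈-map⁺ (entry K) (∈-pairs⁺ K x∈K y∈K))))

-- Inserting a second plane through two independent points would overwrite the first, so these
-- linearly many lookups rule out that two planes of C share a line.
Labelled : PlaneTable → Triple → Set
Labelled τ K = All (λ (x , y) → Degenerate x y ⊎ through τ x y ≡ just K) (pairs K)

labelled? : ∀ τ K → Dec (Labelled τ K)
labelled? τ K = All.all? (λ (x , y) →
  (x ≟V zeroV 7 ⊎-dec y ≟V zeroV 7 ⊎-dec x ≟V y) ⊎-dec
  Maybe.≡-dec _≟T_ (through τ x y) (just K)) (pairs K)

labelled-through : ∀ τ {x y} K → Labelled τ K → x ∈S K → y ∈S K → ¬ Degenerate x y →
  through τ x y ≡ just K
labelled-through τ K labelled x∈K y∈K ¬deg
  with All.lookup labelled (∈-pairs⁺ K x∈K y∈K)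
... | inj₁ deg = contradiction deg ¬deg
... | inj₂ eq  = eq

-- Two independent common points form one key, whose single value would have to be both planes.
labelled-meet : ∀ τ {U W} → Labelled τ U → Labelled τ W → U ≢ W → IntersectDimLe1 U W
labelled-meet τ {U} {W} labU labW U≢W (x , y , x∈U , x∈W , y∈U , y∈W , ind) =
  U≢W (Maybe.just-injective (trans
    (sym (labelled-through τ U labU x∈U y∈U ¬deg)) (labelled-through τ W labW x∈W y∈W ¬deg)))
  where
  ¬deg : ¬ Degenerate x y
  ¬deg = independent⇒¬degenerate ind

-- If the subspaces were equal, the first two basis vectors of `U` would be independent common
-- points.
meet-distinct : ∀ {U W} → IsPlane U → IntersectDimLe1 U W → ¬ SameSpace U W
meet-distinct {a , b , c} plane meet U≈W =
  meet (a , b , a∈S a b c , proj₁ (U≈W a) (a∈S a b c) , b∈S a b c , proj₁ (U≈W b) (b∈S a b c) ,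
        plane-independent a b c plane)

AllPairs-map-All : ∀ {P : A → Set} {R S : A → A → Set} → (∀ {x y} → P x → P y → R x y → S x y) →
  ∀ {xs} → All P xs → AllPairs R xs → AllPairs S xs
AllPairs-map-All f []         []         = []
AllPairs-map-All f (px ∷ pxs) (rx ∷ rxs) =
  All.zipWith (λ (py , r) → f px py r) (pxs , rx) ∷ AllPairs-map-All f pxs rxs

-- `Unique` compares bases only. The table turns different bases into small intersections, and these
-- show that the subspaces differ.
labelled-isCode : ∀ τ {C} → All IsPlane C → Unique C → All (Labelled τ) C → IsCode C
labelled-isCode τ planes unique labelled =
  planes , AllPairs-map-All (λ p _ → meet-distinct p) planes meets , meets
  where meets = AllPairs-map-All (labelled-meet τ) labelled unique

-- Automorphisms

-- The only candidate for the image of `K` is the plane stored for the images of its first two basis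
-- vectors, so one lookup replaces a scan of the code.
Kept : PlaneTable → Mat 7 → Triple → Set
Kept τ M K@(a , b , _) =
  Maybe.Any (λ K′ → SpannedIn (imageT K M) K′ × SpannedIn K′ (imageT K M))
            (through τ (vecMul a M) (vecMul b M))

kept? : ∀ τ M K → Dec (Kept τ M K)
kept? τ M K@(a , b , _) =
  Maybe.dec (λ K′ → spannedIn? (imageT K M) K′ ×-dec spannedIn? K′ (imageT K M)) _

kept⇒image : ∀ C {M} K → Kept (planeTable C) M K → ∃ λ K′ → K′ ∈ C × SameSpace (imageT K M) K′
kept⇒image C {M} K@(a , b , _) kept
  with through (planeTable C) (vecMul a M) (vecMul b M) in eq
kept⇒image C {M} K@(a , b , _) (Maybe.just (⊆ , ⊇)) | just K′ =
  K′ , proj₁ (through-sound C (vecMul a M) (vecMul b M) eq) ,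
  λ x → spannedIn⁻ (imageT K M) K′ ⊆ x , spannedIn⁻ K′ (imageT K M) ⊇ x

isAut-identity : ∀ C → IsAut C (identity 7)
isAut-identity C = (λ K K∈C → K , K∈C , same K) , (λ K K∈C → K , K∈C , same K)
  where
  same : ∀ K → SameSpace (imageT K (identity 7)) K
  same K = subst (SameSpace (imageT K (identity 7))) (image-identity K) (λ _ → (λ p → p) , (λ p → p))

isAut-matMul : ∀ C {M N} → IsAut C M → IsAut C N → IsAut C (matMul M N)
isAut-matMul C {M} {N} (fwdM , bwdM) (fwdN , bwdN) = fwd , bwd
  where
  composed : ∀ K K′ K″ → SameSpace (imageT K M) K′ → SameSpace (imageT K′ N) K″ →
    SameSpace (imageT K (matMul M N)) K″
  composed K K′ K″ KM K′N = subst (λ V → SameSpace V K″) (image-matMul K M N)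
    (SameSpace-trans (imageT (imageT K M) N) (imageT K′ N) K″ (image-cong (imageT K M) K′ N KM) K′N)

  fwd : ∀ K → K ∈ C → ∃ λ K″ → K″ ∈ C × SameSpace (imageT K (matMul M N)) K″
  fwd K K∈C with K′ , K′∈C , KM ← fwdM K K∈C with K″ , K″∈C , K′N ← fwdN K′ K′∈C =
    K″ , K″∈C , composed K K′ K″ KM K′N

  bwd : ∀ K″ → K″ ∈ C → ∃ λ K → K ∈ C × SameSpace (imageT K (matMul M N)) K″
  bwd K″ K″∈C with K′ , K′∈C , K′N ← bwdN K″ K″∈C with K , K∈C , KM ← bwdM K′ K′∈C =
    K , K∈C , composed K K′ K″ KM K′N

-- For an involution the forward half gives the backward half: the plane to which `K′` is sent is
-- itself sent back to `K′`.
isAut-involution : ∀ C {M} → matMul M M ≡ identity 7 → All (Kept (planeTable C) M) C → IsAut C M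
isAut-involution C {M} MM kept = fwd , bwd
  where
  fwd : ∀ K → K ∈ C → ∃ λ K′ → K′ ∈ C × SameSpace (imageT K M) K′
  fwd K K∈C = kept⇒image C K (All.lookup kept K∈C)

  back : ∀ K → imageT (imageT K M) M ≡ K
  back K = trans (image-matMul K M M) (trans (cong (imageT K) MM) (image-identity K))

  bwd : ∀ K′ → K′ ∈ C → ∃ λ K → K ∈ C × SameSpace (imageT K M) K′
  bwd K′ K′∈C with K , K∈C , K′M ← fwd K′ K′∈C =
    K , K∈C , subst (SameSpace (imageT K M)) (back K′)
      (image-cong K (imageT K′ M) M (SameSpace-sym (imageT K′ M) K K′M))

-- A point is coloured by the number of uncovered lines through it, refined by the colours of the
-- points on those lines.
weight : PlaneTable → Trie ℕ 7 → V7 → V7 → ℕ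
weight τ c x y = if is-just (through τ x y) then 0 else lookup c y * lookup c (x +v y)

refine : PlaneTable → Trie ℕ 7 → Trie ℕ 7
-- For nonzero `x` each line through `x` is counted twice, once for each of its other two points.
refine τ c = tabulate (λ x → sum (List.map (weight τ c x) (vectors 7)))

-- If `ps` is the graph of a map on a subspace, sending `b` to `d` forces `x +v b` to go to
-- `y +v d`. The colours are compared at all these new points, not only at `b`.
compatible : Trie ℕ 7 → V7 → V7 → V7 × V7 → Bool
compatible c b d (x , y) = lookup c (x +v b) ≡ᵇ lookup c (y +v d)

-- Adds the graph on the coset of `b`, which doubles the list.
extend : V7 → V7 → List (V7 × V7) → List (V7 × V7)
extend b d ps = ps ++ List.map (λ (x , y) → x +v b , y +v d) ps

-- Opaque, so that the type checker does not unfold them on symbolic codes and maps.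
opaque
  colouring : PlaneTable → ℕ → Trie ℕ 7
  colouring τ zero    = tabulate (λ _ → 1)
  colouring τ (suc k) = refine τ (colouring τ k)

  -- Tests by P the images of the vectors bs under every linear map that preserves the colouring c
  -- and sends x to y for all (x , y) in ps; ps lists the graph of the map on a subspace.
  search : Trie ℕ 7 → Vec V7 m → List (V7 × V7) → (Vec V7 m → Bool) → Bool
  branch : Trie ℕ 7 → V7 → Vec V7 m → List (V7 × V7) → (Vec V7 (suc m) → Bool) → V7 → Bool

  search c []       ps P = P []
  search c (b ∷ bs) ps P = all (branch c b bs ps P) (vectors 7)

  branch c b bs ps P d =
    if all (compatible c b d) ps then search c bs (extend b d ps) (P ∘ (d ∷_)) else true

module _ (c : Trie ℕ 7) (M : Mat 7) (preserved : ∀ x → lookup c (vecMul x M) ≡ lookup c x) where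

  private
    Image : V7 × V7 → Set
    Image (x , y) = vecMul x M ≡ y

  image-compatible : ∀ b {p} → Image p → T (compatible c b (vecMul b M) p)
  image-compatible b {x , _} refl =
    ≡⇒≡ᵇ _ _ (sym (trans (cong (lookup c) (sym (vecMul-+v x b M))) (preserved (x +v b))))

  image-shift : ∀ x b {y} → Image (x , y) → Image (x +v b , y +v vecMul b M)
  image-shift x b refl = vecMul-+v x b M

  T-then : ∀ {b d} → T b → T (if b then d else true) → T d
  T-then {true} _ t = t

  opaque
    unfolding search branch

    -- The search follows the map of `M` itself: at each stage `vecMul b M` is among the images
    -- tried, and it passes the colour test because `M` is linear and preserves colours.
    search-sound : (bs : Vec V7 m) (ps : List (V7 × V7)) (P : Vec V7 m → Bool) → All Image ps →
      T (search c bs ps P) → T (P (Vec.map (λ b → vecMul b M) bs))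
    search-sound []       ps P images t = t
    search-sound (b ∷ bs) ps P images t =
      search-sound bs (extend b (vecMul b M) ps) (P ∘ (vecMul b M ∷_))
        (All.++⁺ images (All.map⁺ (All.map (λ { {x , _} → image-shift x b }) images)))
        (T-then (All.all⁻ (compatible c b (vecMul b M)) (All.map (image-compatible b) images))
                (All.lookup (All.all⁺ (branch c b bs ps P) (vectors 7) t) (∈-vectors (vecMul b M))))

-- Invariance under an automorphism

module _ (C : List Triple) (M : Mat 7) (invertible : Invertible M) (aut : IsAut C M) where

  private
    N : Mat 7
    N = proj₁ invertible

    M-N : ∀ x → vecMul (vecMul x M) N ≡ x
    M-N = vecMul-inverse (proj₁ (proj₂ invertible))

    N-M : ∀ x → vecMul (vecMul x N) M ≡ x
    N-M = vecMul-inverse (proj₂ (proj₂ invertible))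

    τ : PlaneTable
    τ = planeTable C

    injective : ∀ {x y} → vecMul x M ≡ vecMul y M → x ≡ y
    injective {x} {y} eq = trans (sym (M-N x)) (trans (cong (λ z → vecMul z N) eq) (M-N y))

    Covered : V7 → V7 → Set
    Covered x y = ∃ λ K → K ∈ C × x ∈S K × y ∈S K

    covered⇒ : ∀ x y → Covered x y → Covered (vecMul x M) (vecMul y M)
    covered⇒ x y (K , K∈C , x∈K , y∈K) with K′ , K′∈C , KM ← proj₁ aut K K∈C =
      K′ , K′∈C , proj₁ (KM _) (∈S-image⁺ K M x∈K) , proj₁ (KM _) (∈S-image⁺ K M y∈K)

    covered⇐ : ∀ x y → Covered (vecMul x M) (vecMul y M) → Covered x y
    covered⇐ x y (K′ , K′∈C , x∈K′ , y∈K′) with K , K∈C , KM ← proj₂ aut K′ K′∈C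
      with x′ , x′∈K , eqx ← ∈S-image⁻ K M (proj₂ (KM _) x∈K′)
      with y′ , y′∈K , eqy ← ∈S-image⁻ K M (proj₂ (KM _) y∈K′) =
      K , K∈C , subst (_∈S K) (sym (injective eqx)) x′∈K , subst (_∈S K) (sym (injective eqy)) y′∈K

    just⇒covered : ∀ x y → is-just (through τ x y) ≡ true → Covered x y
    just⇒covered x y _ with through τ x y in eq
    just⇒covered x y _ | just K = K , through-sound C x y eq

    covered⇒just : ∀ x y → Covered x y → is-just (through τ x y) ≡ true
    covered⇒just x y (K , K∈C , x∈K , y∈K) =
      cong is-just (proj₂ (through-complete C K∈C x∈K y∈K))

    -- The plane stored for a pair depends on the chosen bases and, for degenerate pairs, on the
    -- order of the list. Only its presence is compared, which says that some plane of the code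
    -- contains both points.
    covered-invariant : ∀ x y →
      is-just (through τ (vecMul x M) (vecMul y M)) ≡ is-just (through τ x y)
    covered-invariant x y = ⇔→≡ (mk⇔
      (covered⇒just x y ∘ covered⇐ x y ∘ just⇒covered (vecMul x M) (vecMul y M))
      (covered⇒just (vecMul x M) (vecMul y M) ∘ covered⇒ x y ∘ just⇒covered x y))

  Preserved : Trie ℕ 7 → Set
  Preserved c = ∀ x → lookup c (vecMul x M) ≡ lookup c x

  weight-invariant : ∀ c → Preserved c → ∀ x y →
    weight τ c (vecMul x M) (vecMul y M) ≡ weight τ c x y
  weight-invariant c preserved x y
    rewrite covered-invariant x y | preserved y | sym (vecMul-+v x y M) | preserved (x +v y) = refl

  -- Replacing `y` by its image under `M` permutes the summands, and afterwards the two sums agree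
  -- term by term.
  refine-preserved : ∀ c → Preserved c → Preserved (refine τ c)
  refine-preserved c preserved x = begin
    lookup (refine τ c) (vecMul x M)
      ≡⟨ lookup-tabulate colour (vecMul x M) ⟩
    sum (List.map (weight τ c (vecMul x M)) (vectors 7))
      ≡⟨ sum-reindex (λ y → vecMul y M) (λ y → vecMul y N) M-N N-M (weight τ c (vecMul x M)) ⟩
    sum (List.map (λ y → weight τ c (vecMul x M) (vecMul y M)) (vectors 7))
      ≡⟨ cong sum (List.map-cong (weight-invariant c preserved x) (vectors 7)) ⟩
    sum (List.map (weight τ c x) (vectors 7))
      ≡⟨ sym (lookup-tabulate colour x) ⟩
    lookup (refine τ c) x ∎
    where
    open ≡-Reasoning
    colour : V7 → ℕ
    colour x = sum (List.map (weight τ c x) (vectors 7))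

  opaque
    unfolding colouring

    colouring-preserved : ∀ k → Preserved (colouring τ k)
    colouring-preserved zero    x =
      trans (lookup-tabulate (λ _ → 1) (vecMul x M)) (sym (lookup-tabulate (λ _ → 1) x))
    colouring-preserved (suc k) = refine-preserved (colouring τ k) (colouring-preserved k)

  -- The images of the first two basis vectors are independent points of the image plane, so the
  -- table must return exactly that plane for them.
  aut-kept : ∀ {K} → IsPlane K → K ∈ C → All (Labelled τ) C → Kept τ M K
  aut-kept {K@(a , b , c)} plane K∈C labelled with K′ , K′∈C , KM ← proj₁ aut K K∈C =
    subst (Maybe.Any _) (sym through≡)
      (Maybe.just (spannedIn⁺ (imageT K M) K′ (λ x → proj₁ (KM x)) ,
                   spannedIn⁺ K′ (imageT K M) (λ x → proj₂ (KM x))))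
    where
    ¬degenerate : ¬ Degenerate (vecMul a M) (vecMul b M)
    ¬degenerate deg = independent⇒¬degenerate (plane-independent a b c plane) (pull deg)
      where
      pull : Degenerate (vecMul a M) (vecMul b M) → Degenerate a b
      pull (inj₁ eq)        = inj₁ (injective (trans eq (sym (vecMul-zeroV M))))
      pull (inj₂ (inj₁ eq)) = inj₂ (inj₁ (injective (trans eq (sym (vecMul-zeroV M)))))
      pull (inj₂ (inj₂ eq)) = inj₂ (inj₂ (injective eq))

    through≡ : through τ (vecMul a M) (vecMul b M) ≡ just K′
    through≡ = labelled-through τ K′ (All.lookup labelled K′∈C)
      (proj₁ (KM _) (a∈S (vecMul a M) (vecMul b M) (vecMul c M)))
      (proj₁ (KM _) (b∈S (vecMul a M) (vecMul b M) (vecMul c M))) ¬degenerate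

-- The Klein four-group

klein : Bool × Bool → Mat 7
klein (false , false) = identity 7
klein (true  , false) = M1
klein (false , true)  = M2
klein (true  , true)  = matMul M1 M2

kleinElements : List (Mat 7)
kleinElements = List.map klein (cartesianProduct bools bools)

-- Evaluating the 16 products includes checking that `M1` and `M2` are commuting involutions.
klein-homomorphic : ∀ g h → klein (kleinOp g h) ≡ matMul (klein g) (klein h)
klein-homomorphic (false , false) (false , false) = refl
klein-homomorphic (false , false) (false , true)  = refl
klein-homomorphic (false , false) (true  , false) = refl
klein-homomorphic (false , false) (true  , true)  = refl
klein-homomorphic (false , true)  (false , false) = refl
klein-homomorphic (false , true)  (false , true)  = refl
klein-homomorphic (false , true)  (true  , false) = refl
klein-homomorphic (false , true)  (true  , true)  = refl
klein-homomorphic (true  , false) (false , false) = refl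
klein-homomorphic (true  , false) (false , true)  = refl
klein-homomorphic (true  , false) (true  , false) = refl
klein-homomorphic (true  , false) (true  , true)  = refl
klein-homomorphic (true  , true)  (false , false) = refl
klein-homomorphic (true  , true)  (false , true)  = refl
klein-homomorphic (true  , true)  (true  , false) = refl
klein-homomorphic (true  , true)  (true  , true)  = refl

-- Two entries of the last row already tell the four matrices apart.
klein⁻¹ : Mat 7 → Bool × Bool
klein⁻¹ (_ ∷ _ ∷ _ ∷ _ ∷ _ ∷ _ ∷ (_ ∷ p ∷ _ ∷ q ∷ _) ∷ []) = q , p

klein⁻¹∘klein : ∀ g → klein⁻¹ (klein g) ≡ g
klein⁻¹∘klein (false , false) = refl
klein⁻¹∘klein (false , true)  = refl
klein⁻¹∘klein (true  , false) = refl
klein⁻¹∘klein (true  , true)  = refl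

generated⇒klein : ∀ {M} → Generated M1 M2 M → ∃ λ g → klein g ≡ M
generated⇒klein gen-id    = (false , false) , refl
generated⇒klein (gen-A p) with g , refl ← generated⇒klein p =
  kleinOp g (true , false) , klein-homomorphic g (true , false)
generated⇒klein (gen-B p) with g , refl ← generated⇒klein p =
  kleinOp g (false , true) , klein-homomorphic g (false , true)

klein⇒generated : ∀ g → Generated M1 M2 (klein g)
klein⇒generated (false , false) = gen-id
klein⇒generated (true  , false) = gen-A gen-id
klein⇒generated (false , true)  = gen-B gen-id
klein⇒generated (true  , true)  = gen-B (gen-A gen-id)

generated-isoToKlein : IsoToKlein (Generated M1 M2)
generated-isoToKlein = klein , klein-homomorphic ,
  (λ g h eq → trans (sym (klein⁻¹∘klein g)) (trans (cong klein⁻¹ eq) (klein⁻¹∘klein h))) ,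
  (λ M → generated⇒klein , (λ { (g , refl) → klein⇒generated g }))

-- The automorphism group of a code

allLabelled? : ∀ τ C → Dec (All (Labelled τ) C)
allLabelled? τ = All.all? (labelled? τ)

allKept? : ∀ τ M C → Dec (All (Kept τ M) C)
allKept? τ M = All.all? (kept? τ M)

-- For an invertible matrix and a labelled code of planes, the second alternative rules out an
-- automorphism by `aut-kept`.
KleinOrBroken : PlaneTable → List Triple → Mat 7 → Set
KleinOrBroken τ C M = M ∈ kleinElements ⊎ ¬ All (Kept τ M) C

opaque
  kleinOrBroken? : ∀ τ C M → Dec (KleinOrBroken τ C M)
  kleinOrBroken? τ C M = M ∈M? kleinElements ⊎-dec ¬? (allKept? τ M C)

-- The search starts from the standard basis, so that it ranges over the rows of a matrix. The
-- fourth refinement of the colouring is the first that leaves only eight of them.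
searchAutomorphisms : PlaneTable → List Triple → Bool
searchAutomorphisms τ C =
  search (colouring τ 4) (identity 7) ((zeroV 7 , zeroV 7) ∷ []) (λ M → ⌊ kleinOrBroken? τ C M ⌋)

kleinElements-generated : ∀ {M} → M ∈ kleinElements → Generated M1 M2 M
kleinElements-generated M∈
  with g , _ , refl ← ∈-map⁻ klein {xs = cartesianProduct bools bools} M∈ = klein⇒generated g

generated-isAut : ∀ C → IsAut C M1 → IsAut C M2 → ∀ {M} → Generated M1 M2 M → IsAut C M
generated-isAut C aut₁ aut₂ gen-id    = isAut-identity C
generated-isAut C aut₁ aut₂ (gen-A p) = isAut-matMul C (generated-isAut C aut₁ aut₂ p) aut₁
generated-isAut C aut₁ aut₂ (gen-B p) = isAut-matMul C (generated-isAut C aut₁ aut₂ p) aut₂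

isAut-generated : ∀ C → All IsPlane C → All (Labelled (planeTable C)) C →
  searchAutomorphisms (planeTable C) C ≡ true →
  ∀ M → Invertible M → IsAut C M → Generated M1 M2 M
isAut-generated C planes labelled found M invertible aut =
  [ kleinElements-generated , (λ broken → contradiction kept broken) ]′ kleinOrBroken
  where
  τ : PlaneTable
  τ = planeTable C

  kept : All (Kept τ M) C
  kept = All.tabulate (λ {K} K∈C → aut-kept C M invertible aut (All.lookup planes K∈C) K∈C labelled)

  kleinOrBroken : KleinOrBroken τ C M
  -- The search speaks of the matrix formed by the images of the standard basis, which is
  -- `matMul (identity 7) M`.
  kleinOrBroken = subst (KleinOrBroken τ C) (matMul-identityˡ M invertible)
    (toWitness {a? = kleinOrBroken? τ C (matMul (identity 7) M)}
      (search-sound (colouring τ 4) M (colouring-preserved C M invertible aut 4)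
        (identity 7) ((zeroV 7 , zeroV 7) ∷ []) (λ M → ⌊ kleinOrBroken? τ C M ⌋)
        -- The initial graph holds only the pair of zero vectors, which belongs to every linear map.
        (vecMul-zeroV M ∷ []) (subst T (sym found) tt)))

-- The code

toVect : ∀ n → ℕ → Vect n
toVect zero    k = []
toVect (suc n) k = (k % 2 ≡ᵇ 1) ∷ toVect n (k / 2)

-- The vector (x₁ , … , x₇) is written as the number Σᵢ xᵢ 2^(i-1).
toTriple : ℕ × ℕ × ℕ → Triple
toTriple (a , b , c) = toVect 7 a , toVect 7 b , toVect 7 c

orbits : List (Mat 7) → List (ℕ × ℕ × ℕ) → List Triple
orbits Ms = concatMap (λ K → List.map (imageT (toTriple K)) Ms)

-- Orbit representatives, by stabilizer in the Klein four-group. They were found by a computer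
-- search: simulated annealing for codes invariant under a group of order 8 containing M1 and M2,
-- followed by annealing among the codes invariant under M1 and M2 only.

fixedPlanes : List (ℕ × ℕ × ℕ)
fixedPlanes =
  (5 , 19 , 41) ∷ (5 , 24 , 40) ∷ (5 , 25 , 34) ∷ (10 , 18 , 65) ∷ (15 , 23 , 99) ∷
  (24 , 34 , 68) ∷ (24 , 39 , 78) ∷ (29 , 34 , 64) ∷ (29 , 39 , 79) ∷ []

M1-fixedPlanes : List (ℕ × ℕ × ℕ)
M1-fixedPlanes =
  (1 , 4 , 10) ∷ (2 , 16 , 45) ∷ (3 , 20 , 36) ∷ (6 , 17 , 43) ∷ (7 , 18 , 34) ∷ (8 , 18 , 32) ∷
  (9 , 23 , 33) ∷ (10 , 23 , 103) ∷ (10 , 39 , 70) ∷ (12 , 23 , 34) ∷ []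

M2-fixedPlanes : List (ℕ × ℕ × ℕ)
M2-fixedPlanes =
  (2 , 29 , 68) ∷ (3 , 60 , 68) ∷ (5 , 32 , 89) ∷ (5 , 33 , 90) ∷ (6 , 27 , 96) ∷ (7 , 56 , 89) ∷
  (8 , 39 , 65) ∷ (9 , 39 , 68) ∷ []

M1M2-fixedPlanes : List (ℕ × ℕ × ℕ)
M1M2-fixedPlanes =
  (2 , 32 , 81) ∷ (3 , 29 , 105) ∷ (5 , 42 , 75) ∷ (5 , 43 , 66) ∷ (6 , 34 , 80) ∷
  (7 , 26 , 73) ∷ (12 , 54 , 86) ∷ (13 , 55 , 70) ∷ []

regularPlanes : List (ℕ × ℕ × ℕ)
regularPlanes =
  (1 , 2 , 24) ∷ (1 , 6 , 50) ∷ (1 , 8 , 82) ∷ (1 , 12 , 116) ∷ (1 , 16 , 72) ∷ (1 , 18 , 108) ∷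
  (1 , 20 , 110) ∷ (1 , 22 , 64) ∷ (1 , 28 , 42) ∷ (1 , 30 , 46) ∷ (1 , 32 , 70) ∷
  (1 , 36 , 78) ∷ (1 , 40 , 74) ∷ (1 , 44 , 92) ∷ (1 , 56 , 68) ∷ (1 , 58 , 94) ∷ (1 , 60 , 84) ∷
  (1 , 62 , 76) ∷ (2 , 5 , 112) ∷ (2 , 9 , 96) ∷ (2 , 12 , 37) ∷ (2 , 17 , 101) ∷ (2 , 20 , 40) ∷
  (2 , 28 , 72) ∷ (2 , 44 , 80) ∷ (2 , 48 , 77) ∷ (2 , 49 , 92) ∷ (2 , 53 , 76) ∷ (2 , 56 , 64) ∷
  (2 , 57 , 85) ∷ (3 , 8 , 33) ∷ (3 , 13 , 64) ∷ (3 , 21 , 69) ∷ (3 , 28 , 109) ∷ (3 , 44 , 85) ∷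
  (3 , 45 , 72) ∷ (3 , 52 , 73) ∷ (3 , 53 , 93) ∷ (3 , 61 , 65) ∷ (5 , 8 , 98) ∷ (6 , 11 , 19) ∷
  (6 , 26 , 64) ∷ (6 , 33 , 88) ∷ (6 , 42 , 73) ∷ (6 , 48 , 89) ∷ (6 , 49 , 83) ∷ (7 , 27 , 98) ∷
  (7 , 40 , 67) ∷ (7 , 41 , 65) ∷ (7 , 49 , 74) ∷ (8 , 19 , 37) ∷ (8 , 36 , 69) ∷ (8 , 51 , 64) ∷
  (8 , 53 , 80) ∷ (8 , 55 , 87) ∷ (9 , 34 , 70) ∷ (9 , 49 , 65) ∷ (10 , 49 , 82) ∷
  (11 , 22 , 36) ∷ (11 , 23 , 68) ∷ (11 , 48 , 69) ∷ (11 , 51 , 71) ∷ (11 , 53 , 82) ∷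
  (12 , 32 , 68) ∷ (12 , 48 , 70) ∷ (12 , 50 , 83) ∷ (24 , 32 , 77) ∷ (24 , 36 , 64) ∷ []

-- Each representative is moved by one element from every coset of its stabilizer, so no orbit is
-- listed with repetitions. The count is 9 + 2·10 + 2·8 + 2·8 + 4·68 = 333.
code : List Triple
code = orbits (identity 7 ∷ []) fixedPlanes
    ++ orbits (identity 7 ∷ M2 ∷ []) M1-fixedPlanes
    ++ orbits (identity 7 ∷ M1 ∷ []) M2-fixedPlanes
    ++ orbits (identity 7 ∷ M1 ∷ []) M1M2-fixedPlanes
    ++ orbits kleinElements regularPlanes

-- Verification of the code by computation

code-unique : Unique code
code-unique = toWitness {a? = unique? code} _

opaque
  -- The checks below concern closed terms, so unfolding lets the type checker evaluate them.
  unfolding coefficients colouring search branch kleinOrBroken?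

  code-planes : All IsPlane code
  code-planes = All.map isPlane (toWitness {a? = All.all? isPlane? code} _)

  code-labelled : All (Labelled (planeTable code)) code
  code-labelled = toWitness {a? = allLabelled? (planeTable code) code} _

  M1-kept : All (Kept (planeTable code) M1) code
  M1-kept = toWitness {a? = allKept? (planeTable code) M1 code} _

  M2-kept : All (Kept (planeTable code) M2) code
  M2-kept = toWitness {a? = allKept? (planeTable code) M2 code} _

  code-search : searchAutomorphisms (planeTable code) code ≡ true
  code-search = refl

theorem2 : ∃ λ (C : List Triple) →
    IsCode C
    × length C ≡ 333
    × (∀ (M : Mat 7) → Invertible M →
    (IsAut C M → Generated M1 M2 M) × (Generated M1 M2 M → IsAut C M))
    × IsoToKlein (Generated M1 M2)
theorem2 =
  code ,
  labelled-isCode (planeTable code) code-planes code-unique code-labelled ,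
  refl ,
  (λ M invertible →
    isAut-generated code code-planes code-labelled code-search M invertible ,
    generated-isAut code (isAut-involution code refl M1-kept) (isAut-involution code refl M2-kept)) ,
  generated-isoToKlein
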